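{- Let $k>1$ be an integer, and let $f_k(m)=\max\{\chi_{\ell}(G^k): G \text{ a graph with } \chi(G^k)=m\}$. If $k$ is even, then $f_k(m)<m^2$. If $k$ is odd, then $f_k(m)<m^3$.
   Context: Graphs are finite and simple. The $k$th power $G^k$ of a graph $G$ is the graph on the same vertex set in which two distinct vertices $u,v$ are adjacent if and only if the distance from $u$ to $v$ in $G$ is at most $k$. $\chi$ denotes the chromatic number. The list-chromatic number $\chi_{\ell}(G)$ is the least $t$ such that for any assignment of lists of size $t$ to the vertices of $G$ there is a proper coloring of $V(G)$ in which the color of each vertex belongs to that vertex's list. Here $m$ denotes a positive integer.
   Formalization: The case m = 1 is excluded (m > 1 is assumed), since there G has no edges, f_k(1) = 1 = 1^2 = 1^3, and the strict inequalities fail. -}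

module Defs where

open import Level using (Level) renaming (zero to 0ℓ)
open import Data.Fin using (Fin)
open import Data.Fin.Properties using (any?) renaming (_≟_ to _≟ᶠ_)
open import Data.List using (List; length)
open import Data.List.Membership.Propositional using (_∈_)
open import Data.List.Relation.Unary.Unique.Propositional using (Unique)
open import Data.Nat using (ℕ; zero; suc; _≤_; _<_; s≤s; s≤s⁻¹)
open import Data.Nat.Properties using (anyUpTo?; allUpTo?; ≮⇒≥; <⇒≱)
open import Data.Product using (_×_; _,_; proj₁; ∃-syntax)
open import Relation.Binary using (Rel; Decidable; Symmetric; Irreflexive)
open import Relation.Binary.PropositionalEquality using (_≡_; _≢_; refl; sym)
open import Relation.Nullary using (¬_)
open import Relation.Nullary.Decidable using (map′; _×-dec_; ¬?)
import Relation.Unary as U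

private
  variable
    ℓ : Level

IsLeast : (ℕ → Set ℓ) → ℕ → Set ℓ
IsLeast P n = P n × (∀ j → P j → n ≤ j)

IsGreatest : (ℕ → Set ℓ) → ℕ → Set ℓ
IsGreatest P n = P n × (∀ j → P j → j ≤ n)

isLeast? : {P : ℕ → Set ℓ} → U.Decidable P → U.Decidable (IsLeast P)
isLeast? {P = P} P? n =
  P? n ×-dec map′ to from (allUpTo? (λ j → ¬? (P? j)) n)
  where
  to : (∀ {j} → j < n → ¬ P j) → ∀ j → P j → n ≤ j
  to none j Pj = ≮⇒≥ (λ j<n → none j<n Pj)

  from : (∀ j → P j → n ≤ j) → ∀ {j} → j < n → ¬ P j
  from least {j} j<n Pj = <⇒≱ j<n (least j Pj)

-- Decidability of adjacency is automatic classically; it is what makes a graph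
-- on a finite vertex set finite data constructively.
record Graph : Set₁ where
  field
    order  : ℕ
    Adj    : Rel (Fin order) 0ℓ
    adj?   : Decidable Adj
    symm   : Symmetric Adj
    irrefl : Irreflexive _≡_ Adj

  Vertex : Set
  Vertex = Fin order

module _ (G : Graph) where
  open Graph G

  data Walk : Vertex → Vertex → ℕ → Set where
    []  : ∀ {u} → Walk u u zero
    _∷_ : ∀ {u v w d} → Adj u v → Walk v w d → Walk u w (suc d)

  -- No d satisfies this when u and v lie in different components
  -- (infinite distance).
  IsDistance : Vertex → Vertex → ℕ → Set
  IsDistance u v = IsLeast (Walk u v)

  walk? : ∀ u v → U.Decidable (Walk u v)
  walk? u v zero    = map′ (λ { refl → [] }) (λ { [] → refl }) (u ≟ᶠ v)
  walk? u v (suc d) =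
    map′ (λ { (_ , e , p) → e ∷ p }) (λ { (e ∷ p) → _ , e , p })
         (any? (λ w → adj? u w ×-dec walk? w v d))

  snoc : ∀ {u v w d} → Walk u v d → Adj v w → Walk u w (suc d)
  snoc []      e = e ∷ []
  snoc (f ∷ p) e = f ∷ snoc p e

  reverse : ∀ {u v d} → Walk u v d → Walk v u d
  reverse []      = []
  reverse (e ∷ p) = snoc (reverse p) (symm e)

  PowerAdj : ℕ → Rel Vertex 0ℓ
  PowerAdj k u v = u ≢ v × ∃[ d ] (IsDistance u v d × d ≤ k)

  powerAdj? : ∀ k → Decidable (PowerAdj k)
  powerAdj? k u v = ¬? (u ≟ᶠ v) ×-dec
    map′ (λ { (d , d<1+k , p) → d , p , s≤s⁻¹ d<1+k })
         (λ { (d , p , d≤k) → d , s≤s d≤k , p })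
         (anyUpTo? (isLeast? (walk? u v)) (suc k))

  power : ℕ → Graph
  power k = record
    { order  = order
    ; Adj    = PowerAdj k
    ; adj?   = powerAdj? k
    ; symm   = λ { (u≢v , d , (p , least) , d≤k) →
                   (λ v≡u → u≢v (sym v≡u))
                 , d , (reverse p , λ j q → least j (reverse q)) , d≤k }
    ; irrefl = λ u≡v adj → proj₁ adj u≡v
    }

  Proper : {C : Set} → (Vertex → C) → Set
  Proper c = ∀ u v → Adj u v → c u ≢ c v

  Colorable : ℕ → Set
  Colorable t = ∃[ c ] Proper {Fin t} c

  IsChromaticNumber : ℕ → Set
  IsChromaticNumber = IsLeast Colorable

  -- Colors are drawn from ℕ: a list assignment on a finite graph involves only
  -- finitely many colors.  Uniqueness makes each list a set of exactly t colors.
  Choosable : ℕ → Set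
  Choosable t =
    (L : Vertex → List ℕ) → (∀ v → Unique (L v) × length (L v) ≡ t) →
    ∃[ c ] (Proper {ℕ} c × (∀ v → c v ∈ L v))

  IsListChromaticNumber : ℕ → Set
  IsListChromaticNumber = IsLeast Choosable

-- Isf k m x means f_k(m) = x.
Isf : ℕ → ℕ → ℕ → Set₁
Isf k m = IsGreatest λ t →
  ∃[ G ] (IsChromaticNumber (power G k) m × IsListChromaticNumber (power G k) t)

{-# OPTIONS --safe #-}

-- If r + r ≤ k, a ball of radius r in G is a clique in G^k, so it has at most
-- m = χ(G^k) vertices.  For k = 2r, a vertex v ≠ w within distance k of w lies
-- in a ball of radius r around one of the at most m vertices u in the ball of w;
-- that ball also contains w, which leaves at most m (m - 1) such v.  For
-- k = 2r + 1 ≤ 3r, one further layer of balls gives at most (1 + m (m - 1)) m.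
-- Greedy colouring needs only one colour more than the degree.
module Submission where

open import Defs
open import Data.Fin using (Fin)
import Data.Fin.Properties as Fin
open import Data.List using (List; []; _∷_; _++_; length; map; filter; concatMap; allFin; lookup)
open import Data.List.Membership.Propositional using (_∈_; _∉_; find; lose)
open import Data.List.Membership.Propositional.Properties
  using (∈-allFin; ∈-filter⁺; ∈-filter⁻; ∈-concatMap⁺; ∈-map⁺; ∈-lookup)
open import Data.List.Membership.Setoid.Properties using (index-injective)
open import Data.List.Properties using (length-++; length-map; filter-notAll)
import Data.List.Relation.Unary.All as All
open import Data.List.Relation.Unary.AllPairs using (_∷_)
open import Data.List.Relation.Unary.Any using (here; there; index; any?)
open import Data.List.Relation.Unary.Unique.Propositional using (Unique)
open import Data.List.Relation.Unary.Unique.Propositional.Properties using (allFin⁺; filter⁺)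
open import Data.Nat using (ℕ; zero; suc; _+_; _*_; _^_; _≤_; _<_; z≤n; s≤s; s≤s⁻¹; _≟_)
open import Data.Nat.Divisibility using (_∣_; _∤_; divides; _∣?_)
open import Data.Nat.DivMod using (_/_; _%_; m≡m%n+[m/n]*n; m%n<n)
open import Data.Nat.Induction using (<-rec)
open import Data.Nat.Properties
open import Data.List.Membership.DecPropositional _≟_ using (_∈?_)
open import Data.Product using (_×_; _,_; proj₁; proj₂; ∃-syntax)
open import Data.Vec.Functional using (updateAt)
open import Data.Vec.Functional.Properties using (updateAt-updates; updateAt-minimal)
open import Function using (_∘_; const; id)
open import Level using (Level)
open import Relation.Binary using (Decidable)
open import Relation.Binary.PropositionalEquality
  using (_≡_; _≢_; refl; sym; trans; cong; subst; setoid; ≢-sym)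
open import Relation.Nullary using (¬_; yes; no; contradiction)
open import Relation.Nullary.Decidable using (map′; ¬?; decidable-stable)
import Relation.Unary as U

private
  variable
    a ℓ : Level
    A B : Set a

-- Least and greatest elements

leastWitness : {P : ℕ → Set ℓ} → U.Decidable P →
               ∀ n → P n → ∃[ d ] (IsLeast P d × d ≤ n)
leastWitness {P = P} P? = <-rec _ step
  where
  step : ∀ n → (∀ {j} → j < n → P j → ∃[ d ] (IsLeast P d × d ≤ j)) →
         P n → ∃[ d ] (IsLeast P d × d ≤ n)
  step n rec Pn with anyUpTo? P? n
  ... | yes (j , j<n , Pj) =
        let d , least , d≤j = rec j<n Pj in d , least , ≤-trans d≤j (<⇒≤ j<n)
  ... | no none =
        n , (Pn , λ j Pj → ≮⇒≥ (λ j<n → none (j , j<n , Pj))) , ≤-refl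

-- Strong induction: without a least element, `P` fails at every number. The double negation makes
-- this usable for choosability, for which no decision procedure is given.
¬¬-least : {P : ℕ → Set ℓ} → ∀ n → P n → ¬ ¬ (∃[ d ] IsLeast P d)
¬¬-least {P = P} n Pn none = <-rec (λ j → ¬ P j)
  (λ j below Pj → none (j , Pj , λ i Pi → ≮⇒≥ (λ i<j → below i<j Pi))) n Pn

-- If `P` held at the bound, the bound would be the greatest element; otherwise the bound drops by
-- one.
¬¬-greatest : {P : ℕ → Set ℓ} → ∀ b → (∀ j → P j → j ≤ b) →
              ∀ n → P n → ¬ ¬ (∃[ d ] IsGreatest P d)
¬¬-greatest {P = P} zero bounded n Pn none =
  none (n , Pn , λ j Pj → ≤-trans (bounded j Pj) z≤n)
¬¬-greatest {P = P} (suc b) bounded n Pn none =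
  ¬¬-greatest b
    (λ j Pj → s≤s⁻¹ (≤∧≢⇒< (bounded j Pj) λ { refl → none (j , Pj , bounded) }))
    n Pn none

-- Counting in lists

lookup-injective : {xs : List A} → Unique xs →
                   ∀ i j → lookup xs i ≡ lookup xs j → i ≡ j
lookup-injective (_ ∷ _)  Fin.zero    Fin.zero    _  = refl
lookup-injective (x≢ ∷ _) Fin.zero    (Fin.suc j) eq =
  contradiction eq (All.lookup x≢ (∈-lookup j))
lookup-injective (x≢ ∷ _) (Fin.suc i) Fin.zero    eq =
  contradiction (sym eq) (All.lookup x≢ (∈-lookup i))
lookup-injective (_ ∷ u)  (Fin.suc i) (Fin.suc j) eq =
  cong Fin.suc (lookup-injective u i j eq)

-- Pigeonhole on the positions of `xs`. The map takes membership proofs, so it can be a colouring or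
-- an `index` into another list.
length-≤-injection : ∀ {n} {xs : List A} → Unique xs →
  (f : ∀ {x} → x ∈ xs → Fin n) →
  (∀ {x y} (x∈ : x ∈ xs) (y∈ : y ∈ xs) → f x∈ ≡ f y∈ → x ≡ y) →
  length xs ≤ n
length-≤-injection unique f inj = Fin.injective⇒≤ {f = λ i → f (∈-lookup i)}
  (λ {i} {j} eq → lookup-injective unique i j (inj (∈-lookup i) (∈-lookup j) eq))

-- Otherwise sending each member of `xs` to its index in `ys` would be an injection into too small a
-- set.
fresh : ∀ {xs ys : List ℕ} → Unique xs → length ys < length xs →
        ∃[ x ] (x ∈ xs × x ∉ ys)
fresh {xs} {ys} unique ys<xs with any? (λ x → ¬? (x ∈? ys)) xs
... | yes some = find some
... | no none  = contradiction
      (length-≤-injection unique (index ∘ inYs)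
        (λ x∈ y∈ → index-injective (setoid ℕ) (inYs x∈) (inYs y∈)))
      (<⇒≱ ys<xs)
  where
  inYs : ∀ {x} → x ∈ xs → x ∈ ys
  inYs x∈ = decidable-stable (_ ∈? ys) (λ x∉ → none (lose x∈ x∉))

length-concatMap-≤ : ∀ {b} (f : A → List B) xs →
  (∀ {x} → x ∈ xs → length (f x) ≤ b) → length (concatMap f xs) ≤ length xs * b
length-concatMap-≤ f []       short = z≤n
length-concatMap-≤ {b = b} f (x ∷ xs) short = begin
  length (f x ++ concatMap f xs)         ≡⟨ length-++ (f x) ⟩
  length (f x) + length (concatMap f xs) ≤⟨ +-mono-≤ (short (here refl))
                                              (length-concatMap-≤ f xs (short ∘ there)) ⟩
  b + length xs * b                      ∎
  where open ≤-Reasoning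

-- Greedy list colouring

module _ (G : Graph) where
  open Graph G

  greedy : ∀ {D} (N : Vertex → List Vertex) → (∀ {u v} → Adj u v → v ∈ N u) →
           (∀ v → length (N v) ≤ D) → Choosable G (suc D)
  greedy {D} N complete short L valid =
    let c , proper , inL = colour (allFin order)
    in  c , (λ u v → proper (∈-allFin u) (∈-allFin v)) , λ v → inL (∈-allFin v)
    where
    ProperOn : List Vertex → (Vertex → ℕ) → Set
    ProperOn vs c = ∀ {u v} → u ∈ vs → v ∈ vs → Adj u v → c u ≢ c v

    colour : ∀ vs → ∃[ c ] (ProperOn vs c × (∀ {v} → v ∈ vs → c v ∈ L v))
    -- Vertices not yet processed hold the placeholder 0; nothing is claimed about colours outside
    -- `vs`.
    colour []       = const 0 , (λ ()) , λ ()
    colour (v ∷ vs) = c′ , proper′ , inL′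
      where
      ih = colour vs
      c = proj₁ ih

      -- Colours on all of `N v` are avoided, placeholders included: the degree bound `D` already
      -- counts every entry.
      room : length (map c (N v)) < length (L v)
      room = begin-strict
        length (map c (N v)) ≡⟨ length-map c (N v) ⟩
        length (N v)         ≤⟨ short v ⟩
        D                    <⟨ n<1+n D ⟩
        suc D                ≡⟨ proj₂ (valid v) ⟨
        length (L v)         ∎
        where open ≤-Reasoning

      new = fresh (proj₁ (valid v)) room
      x = proj₁ new

      c′ : Vertex → ℕ
      c′ = updateAt c v (const x)

      at-v : c′ v ≡ x
      at-v = updateAt-updates v c

      off-v : ∀ {u} → u ≢ v → c′ u ≡ c u
      off-v u≢v = updateAt-minimal _ v c u≢v

      ∈-tail : ∀ {u} → u ≢ v → u ∈ v ∷ vs → u ∈ vs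
      ∈-tail u≢v (here u≡v) = contradiction u≡v u≢v
      ∈-tail u≢v (there u∈) = u∈

      avoids : ∀ {u} → u ≢ v → Adj v u → c′ v ≢ c′ u
      avoids u≢v e eq = proj₂ (proj₂ new)
        (subst (_∈ map c (N v)) (trans (sym (off-v u≢v)) (trans (sym eq) at-v))
          (∈-map⁺ c (complete e)))

      proper′ : ProperOn (v ∷ vs) c′
      proper′ {u} {w} u∈ w∈ e with u Fin.≟ v | w Fin.≟ v
      ... | yes refl | yes refl = contradiction e (irrefl refl)
      ... | yes refl | no w≢v   = avoids w≢v e
      ... | no u≢v   | yes refl = avoids u≢v (symm e) ∘ sym
      ... | no u≢v   | no w≢v   = λ eq →
            proj₁ (proj₂ ih) (∈-tail u≢v u∈) (∈-tail w≢v w∈) e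
              (trans (sym (off-v u≢v)) (trans eq (off-v w≢v)))

      inL′ : ∀ {u} → u ∈ v ∷ vs → c′ u ∈ L u
      inL′ {u} u∈ with u Fin.≟ v
      ... | yes refl = subst (_∈ L v) (sym at-v) (proj₁ (proj₂ new))
      ... | no u≢v   = subst (_∈ L u) (sym (off-v u≢v)) (proj₂ (proj₂ ih) (∈-tail u≢v u∈))

  -- Walks of bounded length and balls

  Near : ℕ → Vertex → Vertex → Set
  Near r u v = ∃[ d ] (d ≤ r × Walk G u v d)

  near? : ∀ r → Decidable (Near r)
  near? r u v = map′
    (λ { (d , d<1+r , p) → d , s≤s⁻¹ d<1+r , p })
    (λ { (d , d≤r , p) → d , s≤s d≤r , p })
    (anyUpTo? (walk? G u v) (suc r))

  near-refl : ∀ {r v} → Near r v v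
  near-refl = 0 , z≤n , []

  near-sym : ∀ {r u v} → Near r u v → Near r v u
  near-sym (d , d≤r , p) = d , d≤r , reverse G p

  near-mono : ∀ {r s u v} → r ≤ s → Near r u v → Near s u v
  near-mono r≤s (d , d≤r , p) = d , ≤-trans d≤r r≤s , p

  append : ∀ {u v w d e} → Walk G u v d → Walk G v w e → Walk G u w (d + e)
  append []      q = q
  append (e ∷ p) q = e ∷ append p q

  near-trans : ∀ {r s u v w} → Near r u v → Near s v w → Near (r + s) u w
  near-trans (d , d≤r , p) (e , e≤s , q) = d + e , +-mono-≤ d≤r e≤s , append p q

  -- Cut the walk after `r` steps; if it ends earlier, the second piece is the empty walk.
  near-split : ∀ r {s u w} → Near (r + s) u w → ∃[ v ] (Near r u v × Near s v w)
  near-split zero    n                    = _ , near-refl , n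
  near-split (suc r) (_ , _ , [])         = _ , near-refl , near-refl
  near-split (suc r) (_ , s≤s d≤ , e ∷ p) =
    let v , (d , d≤r , q) , n = near-split r (_ , d≤ , p)
    in  v , (suc d , s≤s d≤r , e ∷ q) , n

  -- `PowerAdj` asks for an exact distance, which any walk yields because existence of a walk of
  -- given length is decidable. Elsewhere `Near` is preferred: without minimality it composes
  -- freely.
  near⇒powerAdj : ∀ {k u v} → u ≢ v → Near k u v → PowerAdj G k u v
  near⇒powerAdj u≢v (d , d≤k , p) =
    let e , dist , e≤d = leastWitness (walk? G _ _) d p
    in  u≢v , e , dist , ≤-trans e≤d d≤k

  powerAdj⇒near : ∀ {k u v} → PowerAdj G k u v → Near k u v
  powerAdj⇒near (_ , d , (p , _) , d≤k) = d , d≤k , p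

  ball : ℕ → Vertex → List Vertex
  ball r u = filter (near? r u) (allFin order)

  ∈-ball⁺ : ∀ {r u v} → Near r u v → v ∈ ball r u
  ∈-ball⁺ {r} {u} = ∈-filter⁺ (near? r u) (∈-allFin _)

  ∈-ball⁻ : ∀ {r u v} → v ∈ ball r u → Near r u v
  ∈-ball⁻ {r} {u} v∈ = proj₂ (∈-filter⁻ (near? r u) {xs = allFin order} v∈)

  -- A vertex is not its own neighbour, so `w` may be dropped from each ball. This turns m * m into
  -- m * (m - 1) and leaves room for a strict bound.
  puncturedBall : ℕ → Vertex → Vertex → List Vertex
  puncturedBall r w u = filter (λ v → ¬? (v Fin.≟ w)) (ball r u)

  punctured2r : ℕ → Vertex → List Vertex
  punctured2r r w = concatMap (puncturedBall r w) (ball r w)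

  ∈-punctured2r : ∀ {r w v} → v ≢ w → Near (r + r) w v → v ∈ punctured2r r w
  ∈-punctured2r {r} {w} v≢w n =
    let u , w~u , u~v = near-split r n
    in  ∈-concatMap⁺ (puncturedBall r w)
          (lose (∈-ball⁺ w~u) (∈-filter⁺ (λ v → ¬? (v Fin.≟ w)) (∈-ball⁺ u~v) v≢w))

-- Degree bounds from a colouring with m = `suc p` colours

module _ (G : Graph) {k p r}
  (colorable : Colorable (power G k) (suc p)) (2r≤k : r + r ≤ k) where
  open Graph G using (order)

  -- Two vertices of the ball are joined through `u` by a walk of length at most `r + r`, so the
  -- colouring is injective on the ball.
  length-ball : ∀ u → length (ball G r u) ≤ suc p
  length-ball u = length-≤-injection (filter⁺ (near? G r u) (allFin⁺ order))
    (λ {v} _ → c v) λ {v} {w} v∈ w∈ cv≡cw →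
      decidable-stable (v Fin.≟ w) λ v≢w →
        proper v w
          (near⇒powerAdj G v≢w
            (near-mono G 2r≤k (near-trans G (near-sym G (∈-ball⁻ G v∈)) (∈-ball⁻ G w∈))))
          cv≡cw
    where
    c = proj₁ colorable
    proper = proj₂ colorable

  -- By symmetry `w` lies in the ball around `u`, so the filter removes at least one entry.
  length-puncturedBall : ∀ {w u} → u ∈ ball G r w → length (puncturedBall G r w u) ≤ p
  length-puncturedBall {w} {u} u∈ = s≤s⁻¹ (≤-trans
    (filter-notAll (λ v → ¬? (v Fin.≟ w)) (ball G r u)
      (lose (∈-ball⁺ G (near-sym G (∈-ball⁻ G u∈))) (λ w≢w → w≢w refl)))
    (length-ball u))

  length-punctured2r : ∀ w → length (punctured2r G r w) ≤ suc p * p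
  length-punctured2r w = ≤-trans
    (length-concatMap-≤ (puncturedBall G r w) (ball G r w) length-puncturedBall)
    (*-monoˡ-≤ p (length-ball w))

  choosable-2r : k ≤ r + r → Choosable (power G k) (suc (suc p * p))
  choosable-2r k≤2r = greedy (power G k) (punctured2r G r)
    (λ adj → ∈-punctured2r G (≢-sym (proj₁ adj)) (near-mono G k≤2r (powerAdj⇒near G adj)))
    length-punctured2r

  choosable-3r : k ≤ (r + r) + r → Choosable (power G k) (suc (suc (suc p * p) * suc p))
  choosable-3r k≤3r = greedy (power G k) cover complete length-cover
    where
    cover : Graph.Vertex G → List (Graph.Vertex G)
    -- `w` is put back because the centre of the last ball may be `w` itself, which `punctured2r`
    -- omits.
    cover w = concatMap (ball G r) (w ∷ punctured2r G r w)

    complete : ∀ {w v} → PowerAdj G k w v → v ∈ cover w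
    complete {w} adj with near-split G (r + r) (near-mono G k≤3r (powerAdj⇒near G adj))
    ... | u , w~u , u~v = ∈-concatMap⁺ (ball G r) (lose u∈ (∈-ball⁺ G u~v))
      where
      u∈ : u ∈ w ∷ punctured2r G r w
      u∈ with u Fin.≟ w
      ... | yes u≡w = here u≡w
      ... | no u≢w  = there (∈-punctured2r G u≢w w~u)

    length-cover : ∀ w → length (cover w) ≤ suc (suc p * p) * suc p
    length-cover w = ≤-trans
      (length-concatMap-≤ (ball G r) (w ∷ punctured2r G r w) (λ {u} _ → length-ball u))
      (*-monoˡ-≤ (suc p) (s≤s (length-punctured2r w)))

-- Arithmetic and the two parities

n*2≡n+n : ∀ n → n * 2 ≡ n + n
n*2≡n+n n = trans (*-comm n 2) (cong (n +_) (+-identityʳ n))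

-- Since m is at least 2, 2 + m(m - 1) is at most m + m(m - 1), which is m squared.
1+m[m-1]<m^2 : ∀ {p} → 0 < p → suc (suc p * p) < suc p ^ 2
1+m[m-1]<m^2 {p} 0<p = begin
  2 + suc p * p         ≤⟨ +-monoˡ-≤ (suc p * p) (s≤s 0<p) ⟩
  suc p + suc p * p     ≡⟨ *-suc (suc p) p ⟨
  suc p * suc p         ≡⟨ cong (suc p *_) (*-identityʳ (suc p)) ⟨
  suc p ^ 2             ∎
  where open ≤-Reasoning

-- The leading 2 is absorbed into one more copy of m; the previous inequality then bounds the other
-- factor.
1+[1+m[m-1]]m<m^3 : ∀ {p} → 0 < p → suc (suc (suc p * p) * suc p) < suc p ^ 3
1+[1+m[m-1]]m<m^3 {p} 0<p = begin
  2 + s * suc p         ≤⟨ +-monoˡ-≤ (s * suc p) (s≤s 0<p) ⟩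
  suc s * suc p         ≤⟨ *-monoˡ-≤ (suc p) (1+m[m-1]<m^2 0<p) ⟩
  suc p ^ 2 * suc p     ≡⟨ *-comm (suc p ^ 2) (suc p) ⟩
  suc p ^ 3             ∎
  where
  open ≤-Reasoning
  s = suc (suc p * p)

-- The form shared by both parities; it serves the strict bound on f_k(m) and the existence of the
-- maximum alike.
ChoosableBelow : (k m b : ℕ) → Set₁
ChoosableBelow k m b =
  ∀ G → Colorable (power G k) m → ∃[ s ] (s < b × Choosable (power G k) s)

choosableBelow-even : ∀ {k m} → 1 < m → 2 ∣ k → ChoosableBelow k m (m ^ 2)
choosableBelow-even {m = suc p} (s≤s 0<p) (divides r k≡r*2) G colorable =
  _ , 1+m[m-1]<m^2 0<p ,
  choosable-2r G {r = r} colorable (≤-reflexive (sym k≡2r)) (≤-reflexive k≡2r)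
  where k≡2r = trans k≡r*2 (n*2≡n+n r)

2∤⇒odd : ∀ {k} → 2 ∤ k → k ≡ suc (k / 2 * 2)
2∤⇒odd {k} 2∤k with k % 2 | m%n<n k 2 | m≡m%n+[m/n]*n k 2
... | 0             | _               | eq = contradiction (divides (k / 2) eq) 2∤k
... | 1             | _               | eq = eq
... | suc (suc _)   | s≤s (s≤s ())    | _

choosableBelow-odd : ∀ {k m} → 1 < k → 1 < m → 2 ∤ k → ChoosableBelow k m (m ^ 3)
choosableBelow-odd {k} {suc p} 1<k (s≤s 0<p) 2∤k G colorable =
  _ , 1+[1+m[m-1]]m<m^3 0<p ,
  choosable-3r G {r = r} colorable
    (≤-trans (n≤1+n (r + r)) (≤-reflexive (sym k≡1+2r)))
    (≤-trans (≤-reflexive (trans k≡1+2r (+-comm 1 (r + r)))) (+-monoʳ-≤ (r + r) 0<r))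
  where
  r = k / 2
  k≡1+2r : k ≡ suc (r + r)
  k≡1+2r = trans (2∤⇒odd 2∤k) (cong suc (n*2≡n+n r))
  -- This is where `1 < k` enters: 2r + 1 is at most 3r only once r is positive.
  0<r : 0 < r
  0<r = n≢0⇒n>0 λ r≡0 → <⇒≢ 1<k (sym (trans k≡1+2r (cong (λ i → suc (i + i)) r≡0)))

isf< : ∀ {k m b f} → ChoosableBelow k m b → Isf k m f → f < b
isf< below ((G , (colorable , _) , (_ , least)) , _) =
  let s , s<b , choosable = below G colorable in ≤-<-trans (least s choosable) s<b

-- Existence of the maximum

complete : ℕ → Graph
complete m = record
  { order  = m
  ; Adj    = _≢_
  ; adj?   = λ u v → ¬? (u Fin.≟ v)
  ; symm   = ≢-sym
  ; irrefl = λ u≡v u≢v → u≢v u≡v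
  }

χ-power-complete : ∀ {k} m → 0 < k → IsChromaticNumber (power (complete m) k) m
χ-power-complete m 0<k = (id , λ u v → proj₁) , λ where
  j (c , proper) → Fin.injective⇒≤ {f = c} λ {u} {v} cu≡cv →
    decidable-stable (u Fin.≟ v) λ u≢v →
      proper u v (near⇒powerAdj (complete m) u≢v (1 , 0<k , u≢v ∷ [])) cu≡cv

-- The complete graph on m vertices supplies one attained value, and `below` bounds all of them by
-- `b`.
¬¬isf : ∀ {k m b} → 0 < k → ChoosableBelow k m b → ¬ ¬ (∃[ f ] Isf k m f)
¬¬isf {k} {m} {b} 0<k below none =
  let s , _ , choosable = below (complete m) (proj₁ χ≡m)
  in  ¬¬-least s choosable λ { (t , χₗ≡t) →
        ¬¬-greatest b bounded t (complete m , χ≡m , χₗ≡t) none }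
  where
  χ≡m = χ-power-complete m 0<k
  bounded : ∀ j → ∃[ G ] (IsChromaticNumber (power G k) m × IsListChromaticNumber (power G k) j) →
            j ≤ b
  bounded j (G , (colorable , _) , (_ , least)) =
    let s , s<b , choosable = below G colorable in ≤-trans (least s choosable) (<⇒≤ s<b)

-- `1 < m` excludes m = 1, where f_k(1) = 1 and both strict bounds fail. Existence of the maximum is
-- included so that the bounds are not vacuous.
theorem4p1 : (k m : ℕ) → 1 < k → 1 < m →
    (¬ ¬ (∃[ f ] Isf k m f))
    × (∀ f → Isf k m f → (2 ∣ k → f < m ^ 2) × (2 ∤ k → f < m ^ 3))
theorem4p1 k m 1<k 1<m =
  existence , λ f isf → (λ 2∣k → isf< (even 2∣k) isf) , (λ 2∤k → isf< (odd 2∤k) isf)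
  where
  even : 2 ∣ k → ChoosableBelow k m (m ^ 2)
  even = choosableBelow-even 1<m

  odd : 2 ∤ k → ChoosableBelow k m (m ^ 3)
  odd = choosableBelow-odd 1<k 1<m

  existence : ¬ ¬ (∃[ f ] Isf k m f)
  existence with 2 ∣? k
  ... | yes 2∣k = ¬¬isf (<⇒≤ 1<k) (even 2∣k)
  ... | no 2∤k  = ¬¬isf (<⇒≤ 1<k) (odd 2∤k)
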